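{- The ideal $\mathcal R$ on $\omega$ generated by the homogeneous sets in some fixed instance of the random graph on $\omega$ is not $\le_K$-homogeneous (in particular, it is not homogeneous).
   Context: An ideal on a set $X$ is a family of subsets of $X$ closed under finite unions and subsets, containing all finite subsets of $X$ and not containing $X$; $\mathcal I^+=\mathcal P(X)\setminus\mathcal I$. The random graph on $\omega$ is the (unique up to isomorphism) countable graph with vertex set $\omega$ such that for any two disjoint finite sets $U,V\subseteq\omega$ there is a vertex outside $U\cup V$ adjacent to all vertices of $U$ and to none of $V$. A set of vertices is homogeneous (in the graph) if it is a clique or an independent set. $\mathcal R$ consists of all subsets of finite unions of homogeneous sets. For ideals $\mathcal I$ on $X$ and $\mathcal K$ on $Y$, $\mathcal I\le_K\mathcal K$ (Katětov order) means that there is $f:Y\to X$ with $f^{ -1}[B]\in\mathcal K$ for all $B\in\mathcal I$; $\mathcal I$ and $\mathcal K$ are isomorphic if there is a bijection $f:Y\to X$ with $f^{ -1}[B]\in\mathcal K\iff B\in\mathcal I$. For $A\in\mathcal I^+$, $\mathcal I\restriction A=\{B\cap A:B\in\mathcal I\}$ (an ideal on $A$). An ideal $\mathcal I$ is homogeneous if $\mathcal I\restriction A$ is isomorphic to $\mathcal I$ for each $A\in\mathcal I^+$, and $\le_K$-homogeneous if $\mathcal I\restriction A\le_K\mathcal I$ and $\mathcal I\le_K\mathcal I\restriction A$ for each $A\in\mathcal I^+$. -}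

module Defs where

open import Data.Nat.Base using (ℕ; zero; suc; _*_)
open import Data.Nat.Properties using (n<1+n) renaming (_≟_ to _≟ℕ_)
open import Data.Fin.Base using (Fin; zero; suc; toℕ; _<_; combine; remQuot)
open import Data.Fin.Properties using (pigeonhole; remQuot-combine; combine-injective; toℕ-injective; <⇒≢)
  renaming (_≟_ to _≟F_)
open import Data.List.Base using (List; []; _∷_; _++_; foldr; map; filter; allFin; length; lookup)
open import Data.List.Membership.Propositional using (_∈_; _∉_)
open import Data.List.Membership.Propositional.Properties
  using (∈-map⁺; ∈-map⁻; ∈-filter⁺; ∈-filter⁻; ∈-allFin; ∈-lookup)
open import Data.List.Relation.Unary.All as All using (All; []; _∷_)
open import Data.List.Relation.Unary.All.Properties using (++⁺)
open import Data.List.Relation.Unary.Any using (here; there)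
open import Data.List.Relation.Binary.Disjoint.Propositional using (Disjoint)
open import Data.Product using (Σ-syntax; ∃-syntax; _×_; _,_; proj₁; proj₂)
open import Data.Refinement.Base using (Refinement-syntax; value; _,_)
open import Data.Irrelevant using ([_])
open import Data.Sum.Base using (_⊎_; inj₁; inj₂; [_,_]′)
open import Function.Base using (_∘_)
open import Function.Bundles using (_⇔_; _⤖_; Bijection)
open import Level using (0ℓ) renaming (suc to lsuc)
open import Relation.Binary.Core using (Rel)
open import Relation.Binary.Definitions using (Symmetric; Irreflexive)
open import Relation.Binary.PropositionalEquality
  using (_≡_; _≢_; refl; sym; trans; cong; subst)
open import Relation.Nullary using (¬_; yes; no; ¬?; contradiction)
open import Relation.Unary using (Pred; U; ∅; _∪_; _⊆_; _≐_; _⊢_; ｛_｝)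

-- Subsets of X are predicates X → Set.

record Ideal (X : Set) : Set (lsuc (lsuc 0ℓ)) where
  field
    Member   : Pred (Pred X 0ℓ) (lsuc 0ℓ)
    ∪-closed : ∀ {A B} → Member A → Member B → Member (A ∪ B)
    ⊆-closed : ∀ {A B} → A ⊆ B → Member B → Member A
    finite   : ∀ (xs : List X) → Member (_∈ xs)
    proper   : ¬ Member U

infix 4 _∈ᴵ_ _∈⁺_

_∈ᴵ_ : {X : Set} → Pred X 0ℓ → Ideal X → Set (lsuc 0ℓ)
A ∈ᴵ I = Ideal.Member I A

_∈⁺_ : {X : Set} → Pred X 0ℓ → Ideal X → Set (lsuc 0ℓ)
A ∈⁺ I = ¬ (A ∈ᴵ I)

-- A, regarded as a set of its own, is [ x ∈ X ∣ A x ]: the membership proof is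
-- irrelevant, so each x in A is counted once however many proofs of A x exist.
-- `value ⊢ B` is B ∩ A regarded as a subset of A.
restrict : {X : Set} (I : Ideal X) (A : Pred X 0ℓ) → A ∈⁺ I → Ideal [ x ∈ X ∣ A x ]
restrict {X} I A A⁺ = record
  { Member   = λ C → Σ[ B ∈ Pred X 0ℓ ] (B ∈ᴵ I × C ≐ (value ⊢ B))
  ; ∪-closed = λ { (B , b , p , q) (B′ , b′ , p′ , q′) →
      B ∪ B′ , I.∪-closed b b′ ,
      [ inj₁ ∘ p , inj₂ ∘ p′ ]′ , [ inj₁ ∘ q , inj₂ ∘ q′ ]′ }
  ; ⊆-closed = λ { {C} C⊆D (B , b , p , _) →
      (λ x → Σ[ y ∈ [ x ∈ X ∣ A x ] ] (C y × value y ≡ x)) ,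
      I.⊆-closed (λ { (_ , c , refl) → p (C⊆D c) }) b ,
      (λ c → _ , c , refl) ,
      (λ { (_ , c , refl) → c }) }
  ; finite   = λ xs → (_∈ map value xs) , I.finite (map value xs) , ∈-map⁺ value ,
      λ v∈ → let (y , y∈ , eq) = ∈-map⁻ value v∈ in subst (_∈ xs) (value-injective (sym eq)) y∈
  ; proper   = λ { (B , b , U⊆B , _) →
      A⁺ (I.⊆-closed (λ {x} a → U⊆B {x , [ a ]} _) b) }
  }
  where
  module I = Ideal I
  value-injective : {y z : [ x ∈ X ∣ A x ]} → value y ≡ value z → y ≡ z
  value-injective refl = refl

infix 4 _≤K_

_≤K_ : {X Y : Set} → Ideal X → Ideal Y → Set (lsuc 0ℓ)
_≤K_ {X} {Y} I K = Σ[ f ∈ (Y → X) ] (∀ (B : Pred X 0ℓ) → B ∈ᴵ I → (f ⊢ B) ∈ᴵ K)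

Isomorphic : {X Y : Set} → Ideal X → Ideal Y → Set (lsuc 0ℓ)
Isomorphic {X} {Y} I K =
  Σ[ f ∈ (Y ⤖ X) ] (∀ (B : Pred X 0ℓ) → (Bijection.to f ⊢ B) ∈ᴵ K ⇔ B ∈ᴵ I)

Homogeneous : {X : Set} → Ideal X → Set (lsuc 0ℓ)
Homogeneous {X} I = ∀ (A : Pred X 0ℓ) (A⁺ : A ∈⁺ I) → Isomorphic (restrict I A A⁺) I

≤K-Homogeneous : {X : Set} → Ideal X → Set (lsuc 0ℓ)
≤K-Homogeneous {X} I = ∀ (A : Pred X 0ℓ) (A⁺ : A ∈⁺ I) →
  restrict I A A⁺ ≤K I × I ≤K restrict I A A⁺

record RandomGraph : Set (lsuc 0ℓ) where
  field
    Adj       : Rel ℕ 0ℓ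
    symmetric : Symmetric Adj
    loopless  : Irreflexive _≡_ Adj
    extension : ∀ (S T : List ℕ) → Disjoint S T →
                ∃[ v ] (v ∉ S × v ∉ T × All (Adj v) S × All (¬_ ∘ Adj v) T)

module _ (G : RandomGraph) where
  open RandomGraph G

  Clique : Pred ℕ 0ℓ → Set
  Clique H = ∀ {x y} → H x → H y → x ≢ y → Adj x y

  Independent : Pred ℕ 0ℓ → Set
  Independent H = ∀ {x y} → H x → H y → ¬ Adj x y

  HomogeneousSet : Pred (Pred ℕ 0ℓ) 0ℓ
  HomogeneousSet H = Clique H ⊎ Independent H

  ⋃ : List (Pred ℕ 0ℓ) → Pred ℕ 0ℓ
  ⋃ = foldr _∪_ ∅

  MemberR : Pred (Pred ℕ 0ℓ) (lsuc 0ℓ)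
  MemberR A = Σ[ Hs ∈ List (Pred ℕ 0ℓ) ] (All HomogeneousSet Hs × A ⊆ ⋃ Hs)

  ⋃-++⁺ : ∀ Hs Ks → ⋃ Hs ∪ ⋃ Ks ⊆ ⋃ (Hs ++ Ks)
  ⋃-++⁺ []       Ks (inj₂ k)        = k
  ⋃-++⁺ (H ∷ Hs) Ks (inj₁ (inj₁ h)) = inj₁ h
  ⋃-++⁺ (H ∷ Hs) Ks (inj₁ (inj₂ h)) = inj₂ (⋃-++⁺ Hs Ks (inj₁ h))
  ⋃-++⁺ (H ∷ Hs) Ks (inj₂ k)        = inj₂ (⋃-++⁺ Hs Ks (inj₂ k))

  finite-cover : ∀ (xs : List ℕ) → MemberR (_∈ xs)
  finite-cover [] = [] , [] , λ ()
  finite-cover (x ∷ xs) with Hs , hom , cov ← finite-cover xs =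
    ｛ x ｝ ∷ Hs ,
    inj₁ (λ { refl refl x≢x → contradiction refl x≢x }) ∷ hom ,
    λ { (here refl) → inj₁ refl ; (there y∈) → inj₂ (cov y∈) }

  colour : ∀ Hs {x} → ⋃ Hs x → Σ[ c ∈ Fin (length Hs) ] lookup Hs c x
  colour (H ∷ Hs) (inj₁ h) = zero , h
  colour (H ∷ Hs) (inj₂ h) with c , h′ ← colour Hs h = suc c , h′

  -- A disjoint union of cliques, with i and j in the same clique iff r i ≡ r j,
  -- embeds in the graph.
  record Cliques {n} (r : Fin n → ℕ) : Set where
    field
      vertex    : Fin n → ℕ
      injective : ∀ {i j} → i ≢ j → vertex i ≢ vertex j
      same      : ∀ {i j} → i ≢ j → r i ≡ r j → Adj (vertex i) (vertex j)
      different : ∀ {i j} → r i ≢ r j → ¬ Adj (vertex i) (vertex j)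

  cliques : ∀ {n} (r : Fin n → ℕ) → Cliques r
  cliques {zero}  r = record
    { vertex = λ () ; injective = λ { {()} } ; same = λ { {()} } ; different = λ { {()} } }
  cliques {suc n} r = record
    { vertex = a ; injective = inj ; same = same′ ; different = diff }
    where
    module C = Cliques (cliques (r ∘ suc))
    like? = λ (i : Fin n) → r (suc i) ≟ℕ r zero
    S = map C.vertex (filter like? (allFin n))
    T = map C.vertex (filter (¬? ∘ like?) (allFin n))

    vertex-reflects : ∀ {i j} → C.vertex i ≡ C.vertex j → i ≡ j
    vertex-reflects {i} {j} eq with i ≟F j
    ... | yes i≡j = i≡j
    ... | no  i≢j = contradiction eq (C.injective i≢j)

    disjoint : Disjoint S T
    disjoint (s , t)
      with i , i∈ , p ← ∈-map⁻ C.vertex s | j , j∈ , q ← ∈-map⁻ C.vertex t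
      with refl ← vertex-reflects (trans (sym p) q) =
      proj₂ (∈-filter⁻ (¬? ∘ like?) {xs = allFin n} j∈) (proj₂ (∈-filter⁻ like? {xs = allFin n} i∈))

    ext = extension S T disjoint
    v   = proj₁ ext
    v∉S = proj₁ (proj₂ ext)
    v∉T = proj₁ (proj₂ (proj₂ ext))
    v~S = proj₁ (proj₂ (proj₂ (proj₂ ext)))
    v≁T = proj₂ (proj₂ (proj₂ (proj₂ ext)))

    inS : ∀ {i} → r (suc i) ≡ r zero → C.vertex i ∈ S
    inS {i} e = ∈-map⁺ C.vertex (∈-filter⁺ like? (∈-allFin i) e)

    inT : ∀ {i} → r (suc i) ≢ r zero → C.vertex i ∈ T
    inT {i} e = ∈-map⁺ C.vertex (∈-filter⁺ (¬? ∘ like?) (∈-allFin i) e)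

    fresh : ∀ i → v ≢ C.vertex i
    fresh i eq with like? i
    ... | yes e = v∉S (subst (_∈ S) (sym eq) (inS e))
    ... | no  e = v∉T (subst (_∈ T) (sym eq) (inT e))

    a : Fin (suc n) → ℕ
    a zero    = v
    a (suc i) = C.vertex i

    inj : ∀ {i j} → i ≢ j → a i ≢ a j
    inj {zero}  {zero}  ne = contradiction refl ne
    inj {zero}  {suc j} ne = fresh j
    inj {suc i} {zero}  ne = fresh i ∘ sym
    inj {suc i} {suc j} ne = C.injective (ne ∘ cong suc)

    same′ : ∀ {i j} → i ≢ j → r i ≡ r j → Adj (a i) (a j)
    same′ {zero}  {zero}  ne e = contradiction refl ne
    same′ {zero}  {suc j} ne e = All.lookup v~S (inS (sym e))
    same′ {suc i} {zero}  ne e = symmetric (All.lookup v~S (inS e))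
    same′ {suc i} {suc j} ne e = C.same (ne ∘ cong suc) e

    diff : ∀ {i j} → r i ≢ r j → ¬ Adj (a i) (a j)
    diff {zero}  {zero}  ne = contradiction refl ne
    diff {zero}  {suc j} ne = All.lookup v≁T (inT (ne ∘ sym))
    diff {suc i} {zero}  ne = All.lookup v≁T (inT ne) ∘ symmetric
    diff {suc i} {suc j} ne = C.different ne

  -- m homogeneous sets cannot cover m + 1 disjoint cliques of size m + 1:
  -- some set contains an edge from each of two different cliques.
  not-covered : ¬ MemberR U
  not-covered (Hs , hom , cov) = impossible (pigeonhole (n<1+n m) rowColour)
    where
    m = length Hs
    r : Fin (suc m * suc m) → ℕ
    r = toℕ ∘ proj₁ ∘ remQuot {suc m} (suc m)

    module C = Cliques (cliques r)

    point : Fin (suc m) → Fin (suc m) → ℕ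
    point i j = C.vertex (combine i j)

    r-combine : ∀ i j → r (combine i j) ≡ toℕ i
    r-combine i j = cong (toℕ ∘ proj₁) (remQuot-combine {suc m} {suc m} i j)

    col : ∀ i j → Σ[ c ∈ Fin m ] lookup Hs c (point i j)
    col i j = colour Hs (cov {point i j} _)

    row = λ i → pigeonhole (n<1+n m) (proj₁ ∘ col i)
    j₁ = λ i → proj₁ (row i)
    j₂ = λ i → proj₁ (proj₂ (row i))

    rowColour : Fin (suc m) → Fin m
    rowColour i = proj₁ (col i (j₁ i))

    h₁ : ∀ i → lookup Hs (rowColour i) (point i (j₁ i))
    h₁ i = proj₂ (col i (j₁ i))

    h₂ : ∀ i → lookup Hs (rowColour i) (point i (j₂ i))
    h₂ i = subst (λ c → lookup Hs c (point i (j₂ i)))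
                 (sym (proj₂ (proj₂ (proj₂ (row i))))) (proj₂ (col i (j₂ i)))

    edge : ∀ i → Adj (point i (j₁ i)) (point i (j₂ i))
    edge i = C.same {combine i (j₁ i)} {combine i (j₂ i)}
      (<⇒≢ (proj₁ (proj₂ (proj₂ (row i)))) ∘ proj₂ ∘ combine-injective i (j₁ i) i (j₂ i))
      (trans (r-combine i (j₁ i)) (sym (r-combine i (j₂ i))))

    impossible : ¬ (∃[ i ] ∃[ k ] (i < k × rowColour i ≡ rowColour k))
    impossible (i , k , i<k , eq) with All.lookup hom (∈-lookup {xs = Hs} (rowColour i))
    ... | inj₂ ind = ind (h₁ i) (h₂ i) (edge i)
    ... | inj₁ clq = C.different {combine i (j₁ i)} {combine k (j₁ k)}
      (λ e → <⇒≢ i<k (toℕ-injective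
        (trans (sym (r-combine i (j₁ i))) (trans e (r-combine k (j₁ k))))))
      (clq (h₁ i) (subst (λ c → lookup Hs c (point k (j₁ k))) (sym eq) (h₁ k))
        (C.injective (<⇒≢ i<k ∘ proj₁ ∘ combine-injective i (j₁ i) k (j₁ k))))

  R : Ideal ℕ
  R = record
    { Member   = MemberR
    ; ∪-closed = λ { (Hs , hHs , A⊆) (Ks , hKs , B⊆) →
        Hs ++ Ks , ++⁺ hHs hKs , ⋃-++⁺ Hs Ks ∘ [ inj₁ ∘ A⊆ , inj₂ ∘ B⊆ ]′ }
    ; ⊆-closed = λ { A⊆B (Hs , hHs , B⊆) → Hs , hHs , λ a → B⊆ (A⊆B a) }
    ; finite   = finite-cover
    ; proper   = not-covered
    }

{-# OPTIONS --safe #-}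
module Submission where

-- The restriction of R to a union A of infinitely many infinite cliques, with
-- no edges between different cliques, is not Katětov below R.  Number the
-- cliques.  Inside A each single clique lies in R, and so does every set
-- meeting each clique at most once, being independent; but A itself does not
-- lie in R (range-positive).  Suppose f : ω → A witnesses the Katětov
-- reduction, and let g x be the number of the clique containing f x.  Every
-- fibre of g is the preimage of a clique, hence is in R.  No set of R contains
-- all the vertices with prescribed adjacencies to finitely many given vertices
-- (extends-exceeds), so another disjoint union X of infinitely many infinite
-- cliques can be chosen vertex by vertex, each time avoiding the finitely many
-- fibres of g already used.  Then g is injective on X, f[X] is independent,
-- and the preimage of f[X] contains X, which is not in R: a contradiction.
-- Both A and X come from the same construction (clusters), A with g = id.
-- An isomorphism gives a Katětov reduction in particular, so R is not
-- homogeneous either.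
--
-- Adjacency is not assumed decidable and members of R are arbitrary predicates,
-- so "D is not contained in B" would give no vertex to choose.  The relation
-- Exceeds D B replaces it: it does produce a vertex of D satisfying Q, given
-- that every vertex of D satisfies Q or lies in B.  In the construction Q
-- bounds g from below; it is decided by computing g, which is why a vertex
-- outside the used fibres can be found.

open import Defs
open import Data.List.Base using (List; []; _∷_; filter; map)
open import Data.List.Extrema.Nat using (max; xs≤max)
open import Data.List.Membership.Propositional using (_∈_; _∉_)
open import Data.List.Membership.Propositional.Properties
  using (∈-map⁺; ∈-map⁻; ∈-filter⁺; ∈-filter⁻)
open import Data.List.Relation.Binary.Disjoint.Propositional using (Disjoint)
open import Data.List.Relation.Unary.All as All using (All; []; _∷_)
open import Data.List.Relation.Unary.AllPairs using (AllPairs; []; _∷_)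
open import Data.List.Relation.Unary.Any using (here; there)
open import Data.Irrelevant using ([_])
open import Data.Nat.Base using (ℕ; zero; suc; z≤n; s≤s; _≤_; _<_)
open import Data.Nat.Binary.Base using (ℕᵇ; 2[1+_]; 1+[2_]; toℕ; fromℕ)
open import Data.Nat.Binary.Properties using (fromℕ-toℕ; toℕ-fromℕ)
open import Data.Nat.Properties
open import Data.Product using (Σ-syntax; ∃-syntax; _×_; _,_; proj₁; proj₂)
open import Data.Refinement.Base using (Refinement-syntax; value; _,_)
open import Data.Sum.Base using (inj₁; inj₂; assocʳ; [_,_]′)
open import Function.Base using (_∘_; id)
open import Function.Bundles using (Bijection; Equivalence)
open import Level using (0ℓ) renaming (suc to lsuc)
open import Relation.Binary.Definitions using (tri<; tri≈; tri>)
open import Relation.Binary.PropositionalEquality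
  using (_≡_; _≢_; refl; sym; trans; cong; subst; subst₂)
open import Relation.Nullary using (¬_; Dec; yes; no; ¬?; contradiction)
open import Relation.Nullary.Decidable using (map′; recompute)
open import Relation.Unary using (Pred; ∅; _∪_; _⊆_; _⊢_; _≬_)

-- A numbering of ℕ with infinite fibres

leadingOnes : ℕᵇ → ℕ
leadingOnes 1+[2 b ] = suc (leadingOnes b)
leadingOnes _        = 0

-- The number of the clique to which the n-th vertex of a construction belongs;
-- each clique must receive infinitely many n.
label : ℕ → ℕ
label n = leadingOnes (fromℕ n)

label-infinite : ∀ k N → ∃[ n ] (N ≤ n × label n ≡ k)
label-infinite k N = let b , N≤b , eq = large k in
  toℕ b , N≤b , trans (cong leadingOnes (fromℕ-toℕ b)) eq
  where
  -- The tail 2[1+ fromℕ N ] makes the number exceed N; k leading digits keep it so.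
  large : ∀ k → ∃[ b ] (N ≤ toℕ b × leadingOnes b ≡ k)
  large zero    = 2[1+ fromℕ N ] ,
    ≤-trans (≤-reflexive (sym (toℕ-fromℕ N))) (≤-trans (n≤1+n _) (m≤m+n _ _)) , refl
  large (suc k) = let b , N≤b , eq = large k in
    1+[2 b ] , ≤-trans N≤b (≤-trans (m≤m+n _ _) (n≤1+n _)) , cong suc eq

-- Sets that stick out of a given set

-- A positive form of D ⊄ B: whatever Q is offered to complete B to a cover of D,
-- a point of D in Q can be produced.  Q = ∅ recovers the negative statement.
Exceeds : {V : Set} → Pred V 0ℓ → Pred V 0ℓ → Set (lsuc 0ℓ)
Exceeds {V} D B = ∀ (Q : Pred V 0ℓ) → D ⊆ B ∪ Q → D ≬ Q

-- The family D should be read as a forcing notion: a condition c restricts a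
-- vertex to D c, and any given point of H in D c shows how to strengthen c so as
-- to leave H altogether.
Avoidable : {V C : Set} → (C → Pred V 0ℓ) → Pred V 0ℓ → Set
Avoidable {V} {C} D H = ∀ c {v} → D c v → H v →
  ∃[ c′ ] (D c′ ⊆ D c × (∀ {w} → D c′ w → ¬ H w))

-- Absorbing H into Q, the hypothesis on B gives a vertex of D c in Q or in H; a
-- vertex in H allows c to be strengthened beyond H, where only B and Q remain.
-- Whether D c meets H never has to be decided.
exceeds-∪ : {V C : Set} (D : C → Pred V 0ℓ) {H B : Pred V 0ℓ} → Avoidable D H →
  (∀ c → Exceeds (D c) B) → ∀ c → Exceeds (D c) (H ∪ B)
exceeds-∪ D {H} {B} avoid exc c Q cov
  with exc c (H ∪ Q) (λ d → [ [ inj₂ ∘ inj₁ , inj₁ ]′ , inj₂ ∘ inj₂ ]′ (cov d))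
... | v , d , inj₂ q = v , d , q
... | v , d , inj₁ h with c′ , stronger , miss ← avoid c d h =
  let w , d′ , q = exc c′ Q λ d′ →
        [ [ (λ h′ → contradiction h′ (miss d′)) , inj₁ ]′ , inj₂ ]′ (cov (stronger d′))
  in w , stronger d′ , q

module _ (G : RandomGraph) where
  open RandomGraph G

  exceeds-⋃ : {C : Set} (D : C → Pred ℕ 0ℓ) {B : Pred ℕ 0ℓ} → ∀ {Hs} → All (Avoidable D) Hs →
    (∀ c → Exceeds (D c) B) → ∀ c → Exceeds (D c) (⋃ G Hs ∪ B)
  exceeds-⋃ D [] exc c Q cov = exc c Q (λ d → [ [ (λ ()) , inj₁ ]′ , inj₂ ]′ (cov d))
  exceeds-⋃ D (a ∷ as) exc c Q cov =
    exceeds-∪ D a (exceeds-⋃ D as exc) c Q (λ d → [ inj₁ ∘ assocʳ , inj₂ ]′ (cov d))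

  -- Vertices with prescribed adjacencies

  Cell : Set
  Cell = Σ[ S ∈ List ℕ ] Σ[ T ∈ List ℕ ] Disjoint S T

  Extends : Cell → Pred ℕ 0ℓ
  Extends (S , T , _) v = v ∉ S × v ∉ T × All (Adj v) S × All (¬_ ∘ Adj v) T

  -- Once u ∈ H is known, ask new vertices to be non-adjacent to u if H is a
  -- clique, and adjacent to u if H is independent.
  homogeneous-avoidable : ∀ {H} → HomogeneousSet G H → Avoidable Extends H
  homogeneous-avoidable (inj₁ clq) (S , T , S#T) {u} (u∉S , u∉T , _) h =
    (S , u ∷ T , λ { (s , here refl) → u∉S s ; (s , there t) → S#T (s , t) }) ,
    (λ { (w∉S , w∉T , aS , _ ∷ aT) → w∉S , w∉T ∘ there , aS , aT }) ,
    (λ { (_ , w∉T , _ , w≁u ∷ _) h′ → w≁u (clq h′ h (w∉T ∘ here)) })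
  homogeneous-avoidable (inj₂ ind) (S , T , S#T) {u} (u∉S , u∉T , _) h =
    (u ∷ S , T , λ { (here refl , t) → u∉T t ; (there s , t) → S#T (s , t) }) ,
    (λ { (w∉S , w∉T , _ ∷ aS , aT) → w∉S ∘ there , w∉T , aS , aT }) ,
    (λ { (_ , _ , w~u ∷ _ , _) h′ → ind h′ h w~u })

  -- The extension property survives the removal of any set of R.
  extends-exceeds : ∀ {B} → MemberR G B → ∀ c → Exceeds (Extends c) B
  extends-exceeds (Hs , hom , B⊆) c Q cov =
    exceeds-⋃ Extends (All.map homogeneous-avoidable hom) base c Q
      (λ d → [ inj₁ ∘ inj₁ ∘ B⊆ , inj₂ ]′ (cov d))
    where
    base : ∀ c → Exceeds (Extends c) ∅
    base (S , T , S#T) Q cov with v , e ← extension S T S#T =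
      v , e , [ (λ ()) , id ]′ (cov e)

  -- Disjoint unions of infinite cliques

  -- An enumeration of an induced disjoint union of cliques on which g is strictly
  -- increasing.  Increase, not mere injectivity, is what makes membership in the
  -- range decidable when g is the identity.
  record Clusters (g : ℕ → ℕ) : Set where
    field
      vertex     : ℕ → ℕ
      increasing : ∀ {i j} → i < j → g (vertex i) < g (vertex j)
      same       : ∀ {i j} → i ≢ j → label i ≡ label j → Adj (vertex i) (vertex j)
      different  : ∀ {i j} → label i ≢ label j → ¬ Adj (vertex i) (vertex j)

    injective : ∀ {i j} → g (vertex i) ≡ g (vertex j) → i ≡ j
    injective {i} {j} eq with <-cmp i j
    ... | tri< i<j _ _ = contradiction eq (<⇒≢ (increasing i<j))
    ... | tri≈ _ i≡j _ = i≡j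
    ... | tri> _ _ j<i = contradiction (sym eq) (<⇒≢ (increasing j<i))

    Range : Pred ℕ 0ℓ
    Range v = ∃[ n ] vertex n ≡ v

  -- Choosing cliques along which g increases

  module _ {g : ℕ → ℕ} (small : ∀ k → MemberR G (λ v → g v ≡ k)) where

    bounded-small : ∀ N → MemberR G (λ v → g v < N)
    bounded-small zero    = [] , [] , λ ()
    bounded-small (suc N) = ⊆-closed m<1+n⇒m<n∨m≡n (∪-closed (bounded-small N) (small N))
      where open Ideal (R G)

    -- A labelled vertex (k , v) may be added to a construction containing (l , u).
    Follows : ℕ × ℕ → ℕ × ℕ → Set
    Follows (k , v) (l , u) = g u < g v × (k ≡ l → Adj v u) × (k ≢ l → ¬ Adj v u)

    -- Along a construction g increases strictly, so no vertex is repeated.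
    follows-functional : ∀ {L} → AllPairs Follows L →
      ∀ {k l v} → (k , v) ∈ L → (l , v) ∈ L → k ≡ l
    follows-functional (_ ∷ _)  (here refl) (here refl) = refl
    follows-functional (f ∷ _)  (here refl) (there q)   =
      contradiction (proj₁ (All.lookup f q)) (<-irrefl refl)
    follows-functional (f ∷ _)  (there p)   (here refl) =
      contradiction (proj₁ (All.lookup f p)) (<-irrefl refl)
    follows-functional (_ ∷ fs) (there p)   (there q)   = follows-functional fs p q

    sameLabel? : ∀ k (p : ℕ × ℕ) → Dec (k ≡ proj₁ p)
    sameLabel? k p = k ≟ proj₁ p

    neighbours nonNeighbours : ℕ → List (ℕ × ℕ) → List ℕ
    neighbours    k L = map proj₂ (filter (sameLabel? k) L)
    nonNeighbours k L = map proj₂ (filter (¬? ∘ sameLabel? k) L)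

    neighbours-disjoint : ∀ {L} → AllPairs Follows L → ∀ k →
      Disjoint (neighbours k L) (nonNeighbours k L)
    neighbours-disjoint {L} fs k (s , t)
      with _ , p∈ , refl ← ∈-map⁻ proj₂ s | _ , q∈ , refl ← ∈-map⁻ proj₂ t
      with p , k≡ ← ∈-filter⁻ (sameLabel? k) {xs = L} p∈
         | q , k≢ ← ∈-filter⁻ (¬? ∘ sameLabel? k) {xs = L} q∈ =
      k≢ (trans k≡ (follows-functional fs p q))

    -- The vertices at which g does not exceed all its earlier values form a set of
    -- R, so extends-exceeds supplies a vertex outside it with the adjacencies that
    -- the label k prescribes.
    opaque
      next : ∀ L → AllPairs Follows L → ∀ k → ∃[ v ] All (Follows (k , v)) L
      next L fs k =
        let heights = map (g ∘ proj₂) L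
            N = suc (max 0 heights)
            v , (_ , _ , v~ , v≁) , N≤gv =
              extends-exceeds (bounded-small N)
                (neighbours k L , nonNeighbours k L , neighbours-disjoint fs k)
                (λ v → N ≤ g v) (λ {v} _ → <-≤-connex (g v) N)
        in v , All.tabulate λ m →
          <-≤-trans (s≤s (All.lookup (xs≤max 0 heights) (∈-map⁺ (g ∘ proj₂) m))) N≤gv ,
          (λ e → All.lookup v~ (∈-map⁺ proj₂ (∈-filter⁺ (sameLabel? k) m e))) ,
          (λ e → All.lookup v≁ (∈-map⁺ proj₂ (∈-filter⁺ (¬? ∘ sameLabel? k) m e)))

    opaque
      clusters : Clusters g
      clusters = record
        { vertex     = vertex
        ; increasing = λ i<j → proj₁ (follows i<j)
        ; same       = λ {i j} → same {i} {j}
        ; different  = λ {i j} → different {i} {j}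
        }
        where
        history : ℕ → Σ[ L ∈ List (ℕ × ℕ) ] AllPairs Follows L
        history zero    = [] , []
        history (suc n) = let L , fs = history n
                              v , f  = next L fs (label n)
                          in (label n , v) ∷ L , f ∷ fs

        vertex : ℕ → ℕ
        vertex n = let L , fs = history n in proj₁ (next L fs (label n))

        ∈-history : ∀ {i n} → i < n → (label i , vertex i) ∈ proj₁ (history n)
        ∈-history {n = suc n} i<1+n with m<1+n⇒m<n∨m≡n i<1+n
        ... | inj₁ i<n  = there (∈-history i<n)
        ... | inj₂ refl = here refl

        follows : ∀ {i j} → i < j → Follows (label j , vertex j) (label i , vertex i)
        follows {j = j} i<j = let L , fs = history j in
          All.lookup (proj₂ (next L fs (label j))) (∈-history i<j)

        same : ∀ {i j} → i ≢ j → label i ≡ label j → Adj (vertex i) (vertex j)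
        same {i} {j} i≢j e with <-cmp i j
        ... | tri< i<j _ _ = symmetric (proj₁ (proj₂ (follows i<j)) (sym e))
        ... | tri≈ _ i≡j _ = contradiction i≡j i≢j
        ... | tri> _ _ j<i = proj₁ (proj₂ (follows j<i)) e

        different : ∀ {i j} → label i ≢ label j → ¬ Adj (vertex i) (vertex j)
        different {i} {j} ne with <-cmp i j
        ... | tri< i<j _ _ = proj₂ (proj₂ (follows i<j)) (ne ∘ sym) ∘ symmetric
        ... | tri≈ _ i≡j _ = contradiction (cong label i≡j) ne
        ... | tri> _ _ j<i = proj₂ (proj₂ (follows j<i)) ne

  -- A union of infinitely many infinite cliques is not in R

  split : ∀ {Hs} → All (HomogeneousSet G) Hs → ∃[ Cs ] ∃[ Is ]
    (All (λ H → Clique G H) Cs × All (λ H → Independent G H) Is × ⋃ G Hs ⊆ ⋃ G Cs ∪ ⋃ G Is)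
  split [] = [] , [] , [] , [] , λ ()
  split {H ∷ _} (h ∷ hs) with Cs , Is , cs , is , cov ← split hs | h
  ... | inj₁ c = H ∷ Cs , Is , c ∷ cs , is ,
    [ inj₁ ∘ inj₁ , [ inj₁ ∘ inj₂ , inj₂ ]′ ∘ cov ]′
  ... | inj₂ i = Cs , H ∷ Is , cs , i ∷ is ,
    [ inj₂ ∘ inj₁ , [ inj₁ , inj₂ ∘ inj₂ ]′ ∘ cov ]′

  module _ {g : ℕ → ℕ} (X : Clusters g) where
    open Clusters X

    Row : ℕ → Pred ℕ 0ℓ
    Row k v = ∃[ n ] (vertex n ≡ v × label n ≡ k)

    RowFrom : ℕ × ℕ → Pred ℕ 0ℓ
    RowFrom (k , N) v = ∃[ n ] (vertex n ≡ v × label n ≡ k × N ≤ n)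

    RowsFrom : ℕ → Pred ℕ 0ℓ
    RowsFrom K v = ∃[ n ] (vertex n ≡ v × K ≤ label n)

    row-clique : ∀ k → Clique G (Row k)
    row-clique k (i , refl , refl) (j , refl , e) ne = same (ne ∘ cong vertex) (sym e)

    -- An independent set contains at most one vertex of a row, so it is left by
    -- moving further along the row.
    independent-avoidable : ∀ {H} → Independent G H → Avoidable RowFrom H
    independent-avoidable ind (k , N) (n , refl , refl , N≤n) h =
      (k , suc n) ,
      (λ { (i , eq , e , n<i) → i , eq , e , ≤-trans N≤n (<⇒≤ n<i) }) ,
      λ { (i , refl , e , n<i) h′ → ind h h′ (same (<⇒≢ n<i) (sym e)) }

    -- A clique meets at most one row, so it is left by moving to later rows.
    clique-avoidable : ∀ {H} → Clique G H → Avoidable RowsFrom H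
    clique-avoidable clq K (n , refl , K≤n) h =
      suc (label n) ,
      (λ { (i , eq , n<i) → i , eq , ≤-trans K≤n (<⇒≤ n<i) }) ,
      λ { (i , refl , n<i) h′ → different (<⇒≢ n<i)
            (clq h h′ (<⇒≢ n<i ∘ cong label ∘ injective ∘ cong g)) }

    -- Independent sets are dealt with inside a single row, which no finite number
    -- of them can exhaust; only then are the cliques removed, row by row.  The
    -- order matters: one clique can exhaust a row, and one independent set can
    -- meet all rows.
    range-positive : ¬ MemberR G Range
    range-positive (Hs , hom , cov) with Cs , Is , cs , is , cov′ ← split hom =
      proj₂ (proj₂ (exceeds-⋃ RowsFrom (All.map clique-avoidable cs) rows 0 ∅
        (λ { (n , eq , _) → inj₁ (cov′ (cov (n , eq))) })))
      where
      row : ∀ c → Exceeds (RowFrom c) ∅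
      row (k , N) Q cov = let n , N≤n , e = label-infinite k N
                              d = n , refl , e , N≤n
                          in vertex n , d , [ (λ ()) , id ]′ (cov d)

      -- RowsFrom K contains the whole row K, which already exceeds ⋃ Is.
      rows : ∀ K → Exceeds (RowsFrom K) (⋃ G Is)
      rows K Q cov″ =
        let v , (n , eq , e , _) , q =
              exceeds-⋃ RowFrom (All.map independent-avoidable is) row (K , 0) Q
                λ { (n , eq , e , _) →
                    [ inj₁ ∘ inj₁ , inj₂ ]′ (cov″ (n , eq , ≤-reflexive (sym e))) }
        in v , (n , eq , ≤-reflexive (sym e)) , q

  -- The restriction to A is not below R

  homogeneous∈R : ∀ {H} → HomogeneousSet G H → MemberR G H
  homogeneous∈R {H} hom = H ∷ [] , hom ∷ [] , inj₁

  module _ (A : Clusters id) where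
    private module A = Clusters A

    A? : ∀ x → Dec (A.Range x)
    A? x = map′ (λ { (n , _ , e) → n , e })
                (λ { (n , e) → n , s≤s (subst (n ≤_) e (n≤vertex n)) , e })
      (anyUpTo? (λ n → A.vertex n ≟ x) (suc x))
      where
      n≤vertex : ∀ n → n ≤ A.vertex n
      n≤vertex zero    = z≤n
      n≤vertex (suc n) = ≤-<-trans (n≤vertex n) (A.increasing (n<1+n n))

    -- A point of the restricted ground set carries only an irrelevant proof of
    -- membership in A; decidability recovers a usable one.
    index : (y : [ x ∈ ℕ ∣ A.Range x ]) → A.Range (value y)
    index (x , [ p ]) = recompute (A? x) p

    -- The labels of the points f x, for x in X, are strictly increasing, so f[X]
    -- meets each clique of A at most once.
    restriction-≰K : ¬ (restrict (R G) A.Range (range-positive A) ≤K R G)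
    restriction-≰K (f , pull) = range-positive X
      (⊆-closed (λ { (n , refl) → n , refl }) (pull-homogeneous (inj₂ independent)))
      where
      open Ideal (R G)

      pull-homogeneous : ∀ {H} → HomogeneousSet G H → MemberR G ((value ∘ f) ⊢ H)
      pull-homogeneous {H} hom = pull (value ⊢ H) (H , homogeneous∈R hom , id , id)

      i : ℕ → ℕ
      i x = proj₁ (index (f x))

      at : ∀ x → A.vertex (i x) ≡ value (f x)
      at x = proj₂ (index (f x))

      X : Clusters (label ∘ i)
      X = clusters λ k →
        ⊆-closed (λ {x} e → i x , at x , e) (pull-homogeneous (inj₁ (row-clique A k)))
      module X = Clusters X

      Image : Pred ℕ 0ℓ
      Image v = ∃[ n ] value (f (X.vertex n)) ≡ v

      independent : Independent G Image
      independent (m , refl) (n , refl) adj with m ≟ n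
      ... | yes refl = loopless refl adj
      ... | no  m≢n  = A.different {i (X.vertex m)} {i (X.vertex n)} (m≢n ∘ X.injective)
        (subst₂ Adj (sym (at (X.vertex m))) (sym (at (X.vertex n))) adj)

proposition10p4 : (G : RandomGraph) →
    ¬ (≤K-Homogeneous (R G)) × ¬ (Homogeneous (R G))
proposition10p4 G =
  (λ hom → restriction-≰K G A (proj₁ (hom Range positive))) ,
  (λ hom → let f , iso = hom Range positive in
    restriction-≰K G A (Bijection.to f , λ B → Equivalence.from (iso B)))
  where
  A : Clusters G id
  A = clusters G λ k → Ideal.⊆-closed (R G) here (finite-cover G (k ∷ []))
  open Clusters A using (Range)
  positive = range-positive G A
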